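{- Let $F$ be a binary format descriptor with exponent-field width $e_w\ge 2$, fraction-field width $f_w>0$ and bias $b$, and set $P=f_w+1$ and $e_{\min}=1-b-f_w$. Let $R_F:\mathbb{R}\to\mathbb{R}$ be nearest-even rounding on the associated gradual-underflow grid (without upper exponent bound) and $\operatorname{ulp}_F$ the associated grid unit. Then for every real $x$, $$|R_F(x)-x|\le \tfrac12\operatorname{ulp}_F(x).$$ Moreover, if $x\ne 0$ and $|x|\ge 2^{1-b}$, then $$\frac{|R_F(x)-x|}{|x|}\le 2^{ -P}.$$
   Context: A binary format descriptor $F$ records an exponent-field width $e_w\ge2$, a fraction-field width $f_w>0$, an integer bias $b$, and an exceptional-encoding policy; the bias is required to be such that the number one is encodable as a finite normal number (so in particular $1\le b\le 2^{e_w}-1$). Put $P=f_w+1$ and $e_{\min}=1-b-f_w$. For real $x\neq 0$, let $e\in\mathbb{Z}$ be the unique integer with $2^{e-1}\le|x|<2^{e}$, and let $c(x)=\max(e-P,\,e_{\min})$. Define $$R_F(x)=\operatorname{rnd}\bigl(x\,2^{ -c(x)}\bigr)\,2^{c(x)}\quad(x\ne0),\qquad R_F(0)=0,$$ where $\operatorname{rnd}:\mathbb{R}\to\mathbb{Z}$ rounds to the nearest integer, choosing the even integer at a tie. Define $\operatorname{ulp}_F(x)=2^{c(x)}$ for $x\neq0$ and $\operatorname{ulp}_F(0)=2^{e_{\min}}$. -}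

module Defs where

open import Algebra.Bundles using (CommutativeRing)
open import Algebra.Definitions using (Invertible)
open import Data.Bool.Base using (Bool; false)
open import Data.Empty using (⊥-elim)
open import Data.Fin.Base using (Fin; toℕ)
open import Data.Integer.Base as ℤ using (ℤ; +_; -[1+_]; _⊔_)
import Data.Integer.Properties as ℤ
open import Data.Integer.DivMod using (_/ℕ_; _%ℕ_; a≡a%ℕn+[a/ℕn]*n; n%ℕd<d)
open import Data.Integer.Divisibility.Signed using (_∣_; divides)
open import Data.Nat.Base as ℕ using (ℕ; zero; suc)
import Data.Nat.Properties as ℕ
open import Data.Product.Base using (∃-syntax; _×_; _,_; proj₁; proj₂)
open import Data.Rational.Base as ℚ using (ℚ; 1ℚ)
open import Data.Sign.Base using (Sign)
open import Data.Sum.Base using (_⊎_; inj₁; inj₂)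
open import Level using (Level) renaming (suc to lsuc)
open import Relation.Binary.Bundles using (DecTotalOrder)
open import Relation.Binary.Core using (Rel)
open import Relation.Binary.Definitions using (tri<; tri≈; tri>)
open import Relation.Binary.PropositionalEquality as ≡ using (_≡_; _≢_)
open import Relation.Binary.Structures using (IsDecTotalOrder)
open import Relation.Nullary using (¬_; yes; no)
open import Relation.Unary using (Pred; Satisfiable)

import Algebra.Properties.Ring as RingProperties
import Algebra.Properties.Semiring.Exp as Exp
import Algebra.Properties.Semiring.Mult as Mult
import Relation.Binary.Construct.NonStrictToStrict as ToStrict
import Relation.Binary.Properties.DecTotalOrder as DTOProperties
import Relation.Binary.Reasoning.Setoid as ≈-Reasoning

------------------------------------------------------------------------
-- The real numbers, axiomatised (up to isomorphism) as a complete ordered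
-- field with setoid equality.
--
-- The order is decidable, as in classical mathematics: R_F is a
-- discontinuous function defined on all of ℝ.  A supremum is an upper
-- bound s such that every y < s lies below some element of the set;
-- classically this is the least upper bound.  With this reading the
-- Archimedean property is a consequence (see `archimedean`) rather than
-- an axiom.

IsUpperBound : ∀ {ℓ} {A : Set ℓ} → Rel A ℓ → Pred A ℓ → A → Set ℓ
IsUpperBound _≤_ S u = ∀ {x} → S x → x ≤ u

record IsSupremum {ℓ} {A : Set ℓ} (_≤_ _<_ : Rel A ℓ)
                  (S : Pred A ℓ) (s : A) : Set ℓ where
  field
    upper       : IsUpperBound _≤_ S s
    approximate : ∀ {y} → y < s → ∃[ x ] S x × y < x

record Reals (ℓ : Level) : Set (lsuc ℓ) where
  infix 4 _≤_
  field
    commutativeRing : CommutativeRing ℓ ℓ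

  open CommutativeRing commutativeRing public

  field
    _≤_             : Rel Carrier ℓ
    isDecTotalOrder : IsDecTotalOrder _≈_ _≤_
    +-monoˡ-≤       : ∀ z {x y} → x ≤ y → x + z ≤ y + z
    *-nonNegative   : ∀ {x y} → 0# ≤ x → 0# ≤ y → 0# ≤ x * y
    0≉1             : 0# ≉ 1#
    invertible      : ∀ {x} → x ≉ 0# → Invertible _≈_ 1# _*_ x

  open ToStrict _≈_ _≤_ public using (_<_)

  field
    complete        : (S : Pred Carrier ℓ) → Satisfiable S →
                      ∃[ u ] IsUpperBound _≤_ S u →
                      ∃[ s ] IsSupremum _≤_ _<_ S s

  decTotalOrder : DecTotalOrder ℓ ℓ ℓ
  decTotalOrder = record { isDecTotalOrder = isDecTotalOrder }

  open DecTotalOrder decTotalOrder public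
    using (_≟_; _≤?_; total; antisym)
    renaming (refl to ≤-refl; reflexive to ≤-reflexive; trans to ≤-trans)

  open DTOProperties decTotalOrder public
    using (<⇒≱; ≰⇒>; <-compare)

------------------------------------------------------------------------

module RealArithmetic {ℓ : Level} (ℝ : Reals ℓ) where

  open Reals ℝ
  open RingProperties ring
  open Exp semiring using (_^_)
  open Mult semiring using () renaming (_×_ to _·_)

  fromℤ : ℤ → Carrier
  fromℤ (+ n)    = n · 1#
  fromℤ -[1+ n ] = - (suc n · 1#)

  2# : Carrier
  2# = 1# + 1#

  ∣_∣ : Carrier → Carrier
  ∣ x ∣ with 0# ≤? x
  ... | yes _ = x
  ... | no  _ = - x

  _/_[_] : (x y : Carrier) → y ≉ 0# → Carrier
  x / y [ y≉0 ] = x * proj₁ (invertible y≉0)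

  ≈⇒≤ : ∀ {x y} → x ≈ y → x ≤ y
  ≈⇒≤ = ≤-reflexive

  ≤-resp : ∀ {x x′ y y′} → x ≈ x′ → y ≈ y′ → x ≤ y → x′ ≤ y′
  ≤-resp p q x≤y = ≤-trans (≈⇒≤ (sym p)) (≤-trans x≤y (≈⇒≤ q))

  +-monoʳ-≤ : ∀ z {x y} → x ≤ y → z + x ≤ z + y
  +-monoʳ-≤ z x≤y = ≤-resp (+-comm _ _) (+-comm _ _) (+-monoˡ-≤ z x≤y)

  +-mono-≤ : ∀ {x y u v} → x ≤ y → u ≤ v → x + u ≤ y + v
  +-mono-≤ {y = y} {u = u} p q = ≤-trans (+-monoˡ-≤ u p) (+-monoʳ-≤ y q)

  x+y-y : ∀ x y → (x + y) - y ≈ x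
  x+y-y x y = trans (+-assoc _ _ _) (trans (+-congˡ (-‿inverseʳ y)) (+-identityʳ x))

  x-y+y : ∀ x y → (x - y) + y ≈ x
  x-y+y x y = trans (+-assoc _ _ _) (trans (+-congˡ (-‿inverseˡ y)) (+-identityʳ x))

  +-cancelˡ-≤ : ∀ z {x y} → z + x ≤ z + y → x ≤ y
  +-cancelˡ-≤ z p = ≤-resp (x+y-y _ z) (x+y-y _ z)
    (+-monoˡ-≤ (- z) (≤-resp (+-comm _ _) (+-comm _ _) p))

  neg-mono-≤ : ∀ {x y} → x ≤ y → - y ≤ - x
  neg-mono-≤ {x} {y} x≤y = ≤-resp
    (trans (+-comm _ x) (trans (sym (+-assoc _ _ _))
      (trans (+-congʳ (-‿inverseʳ x)) (+-identityˡ _))))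
    (x-y+y (- x) y)
    (+-monoʳ-≤ (- x - y) x≤y)

  neg-0 : - 0# ≈ 0#
  neg-0 = -0#≈0#

  0≤y-x : ∀ {x y} → x ≤ y → 0# ≤ y - x
  0≤y-x {x} x≤y = ≤-resp (-‿inverseʳ x) refl (+-monoˡ-≤ (- x) x≤y)

  y-x≤0 : ∀ {x y} → y ≤ x → y - x ≤ 0#
  y-x≤0 {x} y≤x = ≤-resp refl (-‿inverseʳ x) (+-monoˡ-≤ (- x) y≤x)

  neg-sub : ∀ x y → - (x - y) ≈ y - x
  neg-sub x y = trans (sym (-‿+-comm x (- y)))
    (trans (+-congˡ (-‿involutive y)) (+-comm _ _))

  *-monoˡ-≤ : ∀ {z x y} → 0# ≤ z → x ≤ y → x * z ≤ y * z
  *-monoˡ-≤ {z} {x} {y} 0≤z x≤y =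
    ≤-resp (+-identityˡ _) (x-y+y _ _)
      (+-monoˡ-≤ (x * z) (≤-resp refl
        (trans (distribʳ z y (- x)) (+-congˡ (sym (-‿distribˡ-* x z))))
        (*-nonNegative (0≤y-x x≤y) 0≤z)))

  0≤1 : 0# ≤ 1#
  0≤1 with total 0# 1#
  ... | inj₁ 0≤1 = 0≤1
  ... | inj₂ 1≤0 = ≤-resp refl
    (trans (sym (-‿distribˡ-* 1# (- 1#))) (trans (-‿cong (*-identityˡ _)) (-‿involutive 1#)))
    (*-nonNegative 0≤-1 0≤-1)
    where
    0≤-1 : 0# ≤ - 1#
    0≤-1 = ≤-resp neg-0 refl (neg-mono-≤ 1≤0)

  ¬1≤0 : ¬ (1# ≤ 0#)
  ¬1≤0 1≤0 = 0≉1 (antisym 0≤1 1≤0)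

  x≤1+x : ∀ x → x ≤ 1# + x
  x≤1+x x = ≤-resp (+-identityˡ x) refl (+-monoˡ-≤ x 0≤1)

  1≤2 : 1# ≤ 2#
  1≤2 = x≤1+x 1#

  ¬1+x≤x : ∀ x → ¬ (1# + x ≤ x)
  ¬1+x≤x x p = ¬1≤0 (+-cancelˡ-≤ x (≤-resp (+-comm _ _) (sym (+-identityʳ x)) p))

  <-≤-trans : ∀ {x y z} → x < y → y ≤ z → x < z
  <-≤-trans x<y y≤z = ≰⇒> λ z≤x → <⇒≱ x<y (≤-trans y≤z z≤x)

  abs-nonNeg : ∀ {x} → 0# ≤ x → ∣ x ∣ ≈ x
  abs-nonNeg {x} 0≤x with 0# ≤? x
  ... | yes _   = refl
  ... | no  0≰x = ⊥-elim (0≰x 0≤x)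

  abs-nonPos : ∀ {x} → x ≤ 0# → ∣ x ∣ ≈ - x
  abs-nonPos {x} x≤0 with 0# ≤? x
  ... | yes 0≤x = trans x≈0 (trans (sym neg-0) (-‿cong (sym x≈0)))
    where
    x≈0 : x ≈ 0#
    x≈0 = antisym x≤0 0≤x
  ... | no  _   = refl

  0≤abs : ∀ x → 0# ≤ ∣ x ∣
  0≤abs x with 0# ≤? x
  ... | yes 0≤x = 0≤x
  ... | no  0≰x = ≤-resp neg-0 refl (neg-mono-≤ (proj₁ (≰⇒> 0≰x)))

  ∣x∣≉0 : ∀ {x} → x ≉ 0# → ∣ x ∣ ≉ 0#
  ∣x∣≉0 {x} x≉0 with 0# ≤? x
  ... | yes _ = x≉0
  ... | no  _ = λ -x≈0 → x≉0 (trans (sym (-‿involutive x)) (trans (-‿cong -x≈0) neg-0))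

  2≉0 : 2# ≉ 0#
  2≉0 2≈0 = ¬1≤0 (≤-trans 1≤2 (≈⇒≤ 2≈0))

  ½ : Carrier
  ½ = 1# / 2# [ 2≉0 ]

  2^_ : ℤ → Carrier
  2^ (+ n)    = 2# ^ n
  2^ -[1+ n ] = ½ ^ suc n

  archimedean : ∀ x → ∃[ n ] x < n · 1#
  archimedean x with 0# ≤? x
  ... | no  0≰x = 0 , ≰⇒> 0≰x
  ... | yes 0≤x = suc n , ≰⇒> λ n+1≤x →
          <⇒≱ s-1<y (≤-resp refl refl (y≤s-1 (upper (suc n , refl , n+1≤x))))
    where
    S : Pred Carrier ℓ
    S y = ∃[ n ] y ≈ n · 1# × n · 1# ≤ x
    sup : ∃[ s ] IsSupremum _≤_ _<_ S s
    sup = complete S (0# , 0 , refl , 0≤x)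
      (x , λ { (n , y≈n , n≤x) → ≤-trans (≈⇒≤ y≈n) n≤x })
    s : Carrier
    s = proj₁ sup
    open IsSupremum (proj₂ sup)
    below : ∃[ y ] S y × (s - 1#) < y
    below = approximate (≰⇒> λ s≤s-1 →
      ¬1+x≤x (s - 1#) (≤-resp (trans (sym (x-y+y s 1#)) (+-comm _ _)) refl s≤s-1))
    n : ℕ
    n = proj₁ (proj₁ (proj₂ below))
    s-1<y : (s - 1#) < proj₁ below
    s-1<y = proj₂ (proj₂ below)
    y≤s-1 : 1# + n · 1# ≤ s → proj₁ below ≤ s - 1#
    y≤s-1 p = ≤-trans (≈⇒≤ (proj₁ (proj₂ (proj₁ (proj₂ below)))))
      (+-cancelˡ-≤ 1# (≤-resp refl (trans (sym (x-y+y s 1#)) (+-comm _ _)) p))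

  search : (f : ℕ → Carrier) → ∀ x n → f 0 ≤ x → x < f n →
           ∃[ i ] f i ≤ x × x < f (suc i)
  search f x zero    f₀≤x x<f₀ = ⊥-elim (<⇒≱ x<f₀ f₀≤x)
  search f x (suc n) f₀≤x x<fₛ with f n ≤? x
  ... | yes fₙ≤x = n , fₙ≤x , x<fₛ
  ... | no  fₙ≰x = search f x n f₀≤x (≰⇒> fₙ≰x)

  fromℤ-suc : ∀ n → fromℤ (ℤ.suc n) ≈ 1# + fromℤ n
  fromℤ-suc (+ n)          = refl
  fromℤ-suc -[1+ zero ]    =
    sym (trans (+-congˡ (-‿cong (+-identityʳ 1#))) (-‿inverseʳ 1#))
  fromℤ-suc -[1+ suc n ]   = sym (trans (+-congˡ (sym (-‿+-comm 1# _)))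
    (trans (sym (+-assoc _ _ _)) (trans (+-congʳ (-‿inverseʳ 1#)) (+-identityˡ _))))

  suc-shift : ∀ k n → + suc k ℤ.+ n ≡ ℤ.suc (+ k ℤ.+ n)
  suc-shift k n = ℤ.+-assoc (+ 1) (+ k) n

  fromℤ-shift : ∀ k n → fromℤ n ≤ fromℤ (+ k ℤ.+ n)
  fromℤ-shift zero    n rewrite ℤ.+-identityˡ n = ≤-refl
  fromℤ-shift (suc k) n rewrite suc-shift k n =
    ≤-trans (fromℤ-shift k n)
      (≤-trans (x≤1+x _) (≈⇒≤ (sym (fromℤ-suc (+ k ℤ.+ n)))))

  fromℤ-mono-≤ : ∀ {m n} → m ℤ.≤ n → fromℤ m ≤ fromℤ n
  fromℤ-mono-≤ {m} {n} m≤n =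
    ≡.subst (λ z → fromℤ m ≤ fromℤ z) eq (fromℤ-shift ℤ.∣ n ℤ.- m ∣ m)
    where
    eq : + ℤ.∣ n ℤ.- m ∣ ℤ.+ m ≡ n
    eq = ≡.trans (≡.cong (ℤ._+ m) (ℤ.0≤i⇒+∣i∣≡i (ℤ.i≤j⇒0≤j-i m≤n)))
      (≡.trans (ℤ.+-assoc n (ℤ.- m) m)
        (≡.trans (≡.cong (λ z → n ℤ.+ z) (ℤ.+-inverseˡ m)) (ℤ.+-identityʳ n)))

  fromℤ-mono-< : ∀ {m n} → m ℤ.< n → fromℤ m < fromℤ n
  fromℤ-mono-< {m} {n} m<n = ≰⇒> λ n≤m → ¬1+x≤x (fromℤ m)
    (≤-trans (≤-resp (fromℤ-suc m) refl (fromℤ-mono-≤ (ℤ.i<j⇒suc[i]≤j m<n))) n≤m)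

  fromℤ-neg : ∀ n → fromℤ (ℤ.- (+ n)) ≈ - (n · 1#)
  fromℤ-neg zero    = sym neg-0
  fromℤ-neg (suc n) = refl

  floor : ∀ x → ∃[ n ] fromℤ n ≤ x × x < fromℤ (ℤ.suc n)
  floor x = + i ℤ.+ a , proj₁ (proj₂ found) ,
    ≡.subst (λ z → x < fromℤ z) (suc-shift i a) (proj₂ (proj₂ found))
    where
    lo = archimedean (- x)
    hi = archimedean x
    M N : ℕ
    M = proj₁ lo
    N = proj₁ hi
    a : ℤ
    a = ℤ.- (+ M)
    a≤x : fromℤ (+ 0 ℤ.+ a) ≤ x
    a≤x rewrite ℤ.+-identityˡ a = ≤-resp (sym (fromℤ-neg M)) (-‿involutive x)
      (neg-mono-≤ (proj₁ (proj₂ lo)))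
    eq : + (N ℕ.+ M) ℤ.+ a ≡ + N
    eq = ≡.trans (ℤ.+-assoc (+ N) (+ M) a)
      (≡.trans (≡.cong (λ z → + N ℤ.+ z) (ℤ.+-inverseʳ (+ M))) (ℤ.+-identityʳ (+ N)))
    found = search (λ i → fromℤ (+ i ℤ.+ a)) x (N ℕ.+ M) a≤x
      (≡.subst (λ z → x < fromℤ z) (≡.sym eq) (proj₂ hi))
    i : ℕ
    i = proj₁ found

  even-or-suc-even : ∀ n → (+ 2 ∣ n) ⊎ (+ 2 ∣ ℤ.suc n)
  even-or-suc-even n with n %ℕ 2 | a≡a%ℕn+[a/ℕn]*n n 2 | n%ℕd<d n 2
  ... | 0 | eq | _ = inj₁ (divides (n /ℕ 2) (≡.trans eq (ℤ.+-identityˡ _)))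
  ... | 1 | eq | _ = inj₂ (divides (ℤ.suc (n /ℕ 2))
    (≡.trans (≡.cong ℤ.suc eq)
      (≡.trans (≡.sym (ℤ.+-assoc (+ 1) (+ 1) ((n /ℕ 2) ℤ.* + 2)))
               (≡.sym (ℤ.suc-* (n /ℕ 2) (+ 2))))))
  ... | suc (suc _) | _ | ℕ.s≤s (ℕ.s≤s ())

  record IsNearestEven (x : Carrier) (n : ℤ) : Set ℓ where
    field
      nearest  : ∀ m → ∣ x - fromℤ n ∣ ≤ ∣ x - fromℤ m ∣
      tie-even : ∀ m → m ≢ n → ∣ x - fromℤ m ∣ ≈ ∣ x - fromℤ n ∣ → + 2 ∣ n

  nearestEven : ∀ x → ∃[ n ] IsNearestEven x n
  nearestEven x with floor x
  ... | k , k≤x , x<k+1 = result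
    where
    dist : ℤ → Carrier
    dist m = ∣ x - fromℤ m ∣

    lower : ∀ {m} → m ℤ.≤ k → dist m ≈ x - fromℤ m
    lower m≤k = abs-nonNeg (0≤y-x (≤-trans (fromℤ-mono-≤ m≤k) k≤x))

    upper : ∀ {m} → ℤ.suc k ℤ.≤ m → dist m ≈ fromℤ m - x
    upper {m} k<m = trans
      (abs-nonPos (y-x≤0 (≤-trans (proj₁ x<k+1) (fromℤ-mono-≤ k<m)))) (neg-sub x (fromℤ m))

    lower-≤ : ∀ {m} → m ℤ.≤ k → dist k ≤ dist m
    lower-≤ m≤k = ≤-resp (sym (lower ℤ.≤-refl)) (sym (lower m≤k))
      (+-monoʳ-≤ x (neg-mono-≤ (fromℤ-mono-≤ m≤k)))

    upper-≤ : ∀ {m} → ℤ.suc k ℤ.≤ m → dist (ℤ.suc k) ≤ dist m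
    upper-≤ k<m = ≤-resp (sym (upper ℤ.≤-refl)) (sym (upper k<m))
      (+-monoˡ-≤ (- x) (fromℤ-mono-≤ k<m))

    lower-≉ : ∀ {m} → m ℤ.< k → dist m ≉ dist k
    lower-≉ {m} m<k p = proj₂ (fromℤ-mono-< m<k)
      (-‿injective (+-cancelˡ x _ _
        (trans (sym (lower (ℤ.<⇒≤ m<k))) (trans p (lower ℤ.≤-refl)))))

    upper-≉ : ∀ {m} → ℤ.suc k ℤ.< m → dist m ≉ dist (ℤ.suc k)
    upper-≉ {m} k+1<m p = proj₂ (fromℤ-mono-< k+1<m)
      (sym (+-cancelʳ (- x) _ _
        (trans (sym (upper (ℤ.<⇒≤ k+1<m))) (trans p (upper ℤ.≤-refl)))))

    side : ∀ m → m ℤ.≤ k ⊎ ℤ.suc k ℤ.≤ m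
    side m with m ℤ.≤? k
    ... | yes m≤k = inj₁ m≤k
    ... | no  m≰k = inj₂ (ℤ.i<j⇒suc[i]≤j (ℤ.≰⇒> m≰k))

    nearest-k : dist k ≤ dist (ℤ.suc k) → ∀ m → dist k ≤ dist m
    nearest-k p m with side m
    ... | inj₁ m≤k = lower-≤ m≤k
    ... | inj₂ k<m = ≤-trans p (upper-≤ k<m)

    nearest-suc : dist (ℤ.suc k) ≤ dist k → ∀ m → dist (ℤ.suc k) ≤ dist m
    nearest-suc p m with side m
    ... | inj₁ m≤k = ≤-trans p (lower-≤ m≤k)
    ... | inj₂ k<m = upper-≤ k<m

    no-tie-k : dist k < dist (ℤ.suc k) → ∀ m → m ≢ k → dist m ≉ dist k
    no-tie-k p m m≢k q with side m
    ... | inj₁ m≤k = lower-≉ (ℤ.≤∧≢⇒< m≤k m≢k) q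
    ... | inj₂ k<m = <⇒≱ p (≤-trans (upper-≤ k<m) (≈⇒≤ q))

    no-tie-suc : dist (ℤ.suc k) < dist k → ∀ m → m ≢ ℤ.suc k → dist m ≉ dist (ℤ.suc k)
    no-tie-suc p m m≢k+1 q with side m
    ... | inj₁ m≤k = <⇒≱ p (≤-trans (lower-≤ m≤k) (≈⇒≤ q))
    ... | inj₂ k<m = upper-≉ (ℤ.≤∧≢⇒< k<m (λ eq → m≢k+1 (≡.sym eq))) q

    result : ∃[ n ] IsNearestEven x n
    result with <-compare (dist k) (dist (ℤ.suc k))
    ... | tri< p _ _ = k , record
      { nearest  = nearest-k (proj₁ p)
      ; tie-even = λ m m≢k q → ⊥-elim (no-tie-k p m m≢k q) }
    ... | tri> _ _ p = ℤ.suc k , record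
      { nearest  = nearest-suc (proj₁ p)
      ; tie-even = λ m m≢k q → ⊥-elim (no-tie-suc p m m≢k q) }
    ... | tri≈ _ p _ with even-or-suc-even k
    ...   | inj₁ 2∣k = k , record
      { nearest = nearest-k (≈⇒≤ p) ; tie-even = λ _ _ _ → 2∣k }
    ...   | inj₂ 2∣k+1 = ℤ.suc k , record
      { nearest = nearest-suc (≈⇒≤ (sym p)) ; tie-even = λ _ _ _ → 2∣k+1 }

  rnd : Carrier → ℤ
  rnd x = proj₁ (nearestEven x)

  record IsExponent (x : Carrier) (e : ℤ) : Set ℓ where
    field
      lower : 2^ (e ℤ.- + 1) ≤ ∣ x ∣
      upper : ∣ x ∣ < 2^ e

  0≤½ : 0# ≤ ½
  0≤½ with total 0# ½
  ... | inj₁ 0≤½ = 0≤½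
  ... | inj₂ ½≤0 = ⊥-elim (¬1≤0 (≤-resp
    (trans (*-congʳ (*-identityˡ _)) (proj₁ (proj₂ (invertible 2≉0))))
    (zeroˡ 2#) (*-monoˡ-≤ (≤-trans 0≤1 1≤2) ½≤0)))

  0≤^ : ∀ {x} n → 0# ≤ x → 0# ≤ x ^ n
  0≤^ zero    0≤x = 0≤1
  0≤^ (suc n) 0≤x = *-nonNegative 0≤x (0≤^ n 0≤x)

  1≤2^ : ∀ n → 1# ≤ 2# ^ n
  1≤2^ zero    = ≤-refl
  1≤2^ (suc n) = ≤-trans (1≤2^ n) (≤-resp (*-identityˡ _) refl
    (*-monoˡ-≤ (0≤^ n (≤-trans 0≤1 1≤2)) 1≤2))

  n≤2^n : ∀ n → n · 1# ≤ 2# ^ n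
  n≤2^n zero    = 0≤1
  n≤2^n (suc n) = ≤-trans (+-mono-≤ (1≤2^ n) (n≤2^n n))
    (≈⇒≤ (sym (trans (distribʳ _ 1# 1#) (+-cong (*-identityˡ _) (*-identityˡ _)))))

  ½*2≈1 : ½ * 2# ≈ 1#
  ½*2≈1 = trans (*-congʳ (*-identityˡ _)) (proj₁ (proj₂ (invertible 2≉0)))

  ½^*2^ : ∀ n → ½ ^ n * 2# ^ n ≈ 1#
  ½^*2^ zero    = *-identityˡ 1#
  ½^*2^ (suc n) = begin
    (½ * ½ ^ n) * (2# * 2# ^ n)   ≈⟨ *-assoc _ _ _ ⟩
    ½ * (½ ^ n * (2# * 2# ^ n))   ≈⟨ *-congˡ (*-assoc _ _ _) ⟨
    ½ * ((½ ^ n * 2#) * 2# ^ n)   ≈⟨ *-congˡ (*-congʳ (*-comm _ _)) ⟩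
    ½ * ((2# * ½ ^ n) * 2# ^ n)   ≈⟨ *-congˡ (*-assoc _ _ _) ⟩
    ½ * (2# * (½ ^ n * 2# ^ n))   ≈⟨ *-assoc _ _ _ ⟨
    (½ * 2#) * (½ ^ n * 2# ^ n)   ≈⟨ *-cong ½*2≈1 (½^*2^ n) ⟩
    1# * 1#                       ≈⟨ *-identityˡ 1# ⟩
    1#                            ∎
    where open ≈-Reasoning setoid

  2^-neg : ∀ n → 2^ (ℤ.- (+ n)) ≈ ½ ^ n
  2^-neg zero    = refl
  2^-neg (suc n) = refl

  exponent : ∀ {x} → x ≉ 0# → ∃[ e ] IsExponent x e
  exponent {x} x≉0 = ℤ.suc (+ i ℤ.+ a) , record
    { lower = ≡.subst (λ z → 2^ z ≤ y) (≡.sym (cancel (+ i ℤ.+ a))) (proj₁ (proj₂ found))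
    ; upper = ≡.subst (λ z → y < 2^ z) (suc-shift i a) (proj₂ (proj₂ found))
    }
    where
    y y⁻¹ : Carrier
    y = ∣ x ∣
    y⁻¹ = proj₁ (invertible (∣x∣≉0 x≉0))
    lo = archimedean y⁻¹
    hi = archimedean y
    M N : ℕ
    M = proj₁ lo
    N = proj₁ hi
    a : ℤ
    a = ℤ.- (+ M)
    1≤2^M*y : 1# ≤ 2# ^ M * y
    1≤2^M*y = ≤-resp (proj₁ (proj₂ (invertible (∣x∣≉0 x≉0)))) refl
      (*-monoˡ-≤ (0≤abs x) (≤-trans (proj₁ (proj₂ lo)) (n≤2^n M)))
    a≤y : 2^ (+ 0 ℤ.+ a) ≤ y
    a≤y rewrite ℤ.+-identityˡ a = ≤-resp
      (trans (*-identityˡ _) (sym (2^-neg M)))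
      (trans (*-comm _ _) (trans (sym (*-assoc _ _ _)) (trans (*-congʳ (½^*2^ M)) (*-identityˡ y))))
      (*-monoˡ-≤ (0≤^ M 0≤½) 1≤2^M*y)
    eq : + (N ℕ.+ M) ℤ.+ a ≡ + N
    eq = ≡.trans (ℤ.+-assoc (+ N) (+ M) a)
      (≡.trans (≡.cong (λ z → + N ℤ.+ z) (ℤ.+-inverseʳ (+ M))) (ℤ.+-identityʳ (+ N)))
    found = search (λ i → 2^ (+ i ℤ.+ a)) y (N ℕ.+ M) a≤y
      (≡.subst (λ z → y < 2^ z) (≡.sym eq) (<-≤-trans (proj₂ hi) (n≤2^n N)))
    i : ℕ
    i = proj₁ found
    cancel : ∀ z → ℤ.suc z ℤ.- + 1 ≡ z
    cancel z = ≡.trans (≡.cong (ℤ._- + 1) (ℤ.+-comm (+ 1) z))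
      (≡.trans (ℤ.+-assoc z (+ 1) (ℤ.- (+ 1))) (ℤ.+-identityʳ z))

------------------------------------------------------------------------
-- Binary format descriptors

record Encoding (expWidth fracWidth : ℕ) : Set where
  field
    sign     : Sign
    exponent : Fin (2 ℕ.^ expWidth)
    fraction : Fin (2 ℕ.^ fracWidth)

2^ℚ_ : ℤ → ℚ
2^ℚ (+ n)    = + (2 ℕ.^ n) ℚ./ 1
2^ℚ -[1+ n ] = (+ 1 ℚ./ (2 ℕ.^ suc n)) {{ℕ.m^n≢0 2 (suc n)}}

-- ± (2^f_w + M) · 2^(E - b - f_w), that is, ± (1 + M / 2^f_w) · 2^(E - b).
normalValue : ∀ {ew fw} → ℤ → Encoding ew fw → ℚ
normalValue {fw = fw} b c =
  ((sign ℤ.◃ (2 ℕ.^ fw ℕ.+ toℕ fraction)) ℚ./ 1) ℚ.* 2^ℚ (+ toℕ exponent ℤ.- b ℤ.- + fw)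
  where open Encoding c

-- The exceptional-encoding policy is an arbitrary set of bit patterns
-- that do not denote finite numbers (infinities, NaNs).
record Format : Set where
  field
    expWidth    : ℕ
    fracWidth   : ℕ
    bias        : ℤ
    exceptional : Encoding expWidth fracWidth → Bool
    2≤expWidth  : 2 ℕ.≤ expWidth
    0<fracWidth : 0 ℕ.< fracWidth
    one-normal  : ∃[ c ] exceptional c ≡ false
                       × toℕ (Encoding.exponent c) ≢ 0
                       × normalValue bias c ≡ 1ℚ

  P : ℤ
  P = + (fracWidth ℕ.+ 1)

  eₘᵢₙ : ℤ
  eₘᵢₙ = + 1 ℤ.- bias ℤ.- + fracWidth

------------------------------------------------------------------------

module Rounding {ℓ : Level} (ℝ : Reals ℓ) (F : Format) where

  open Reals ℝ
  open RealArithmetic ℝ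
  open Format F

  c : ∀ {x} → x ≉ 0# → ℤ
  c x≉0 = (proj₁ (exponent x≉0) ℤ.- P) ⊔ eₘᵢₙ

  R : Carrier → Carrier
  R x with x ≟ 0#
  ... | yes _   = 0#
  ... | no  x≉0 = fromℤ (rnd (x * 2^ (ℤ.- c x≉0))) * 2^ (c x≉0)

  ulp : Carrier → Carrier
  ulp x with x ≟ 0#
  ... | yes _   = 2^ eₘᵢₙ
  ... | no  x≉0 = 2^ (c x≉0)

{-# OPTIONS --safe #-}

-- An integer nearest to y is at distance at most ½ from y, because the
-- distances from y to ⌊y⌋ and ⌊y⌋ + 1 add up to 1; rescaling by 2^c gives
-- the absolute bound.  If |x| ≥ 2^(1 - b) then the exponent e of x satisfies
-- e ≥ 2 - b, so the maximum defining c is attained by e - P, and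
-- ½ 2^(e - P) = 2^(e - 1) 2^(-P) ≤ |x| 2^(-P).

module Submission where

open import Defs
open import Level using (Level)
open import Data.Empty using (⊥-elim)
open import Data.Integer.Base as ℤ using (ℤ; +_; -[1+_])
import Data.Integer.Properties as ℤ
open import Data.Nat.Base as ℕ using (ℕ; zero; suc)
open import Data.Product.Base using (_×_; _,_; proj₁; proj₂)
open import Data.Sum.Base using (inj₁; inj₂)
open import Relation.Binary.PropositionalEquality as ≡ using (_≡_)
open import Relation.Nullary using (yes; no)

import Algebra.Properties.Ring as RingProperties
import Algebra.Properties.Semiring.Exp as Exp
import Relation.Binary.Reasoning.Setoid as ≈-Reasoning

module _ {ℓ : Level} (ℝ : Reals ℓ) where

  open Reals ℝ
  open RealArithmetic ℝ
  open RingProperties ring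
  open Exp semiring using (_^_)

  -- Absolute values and division in the ordered field

  0≤2 : 0# ≤ 2#
  0≤2 = ≤-trans 0≤1 1≤2

  -- `∣_∣` tests the sign of its argument, so setoid equality has to be carried through it: one sign
  -- choice, made at `x`, is transported to `y`.
  abs-cong : ∀ {x y} → x ≈ y → ∣ x ∣ ≈ ∣ y ∣
  abs-cong {x} x≈y with total 0# x
  ... | inj₁ 0≤x = trans (abs-nonNeg 0≤x)
    (trans x≈y (sym (abs-nonNeg (≤-resp refl x≈y 0≤x))))
  ... | inj₂ x≤0 = trans (abs-nonPos x≤0)
    (trans (-‿cong x≈y) (sym (abs-nonPos (≤-resp x≈y refl x≤0))))

  abs-neg : ∀ x → ∣ - x ∣ ≈ ∣ x ∣
  abs-neg x with total 0# x
  ... | inj₁ 0≤x = trans (abs-nonPos (≤-resp refl neg-0 (neg-mono-≤ 0≤x)))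
    (trans (-‿involutive x) (sym (abs-nonNeg 0≤x)))
  ... | inj₂ x≤0 = trans (abs-nonNeg (≤-resp neg-0 refl (neg-mono-≤ x≤0)))
    (sym (abs-nonPos x≤0))

  abs-sub-comm : ∀ x y → ∣ x - y ∣ ≈ ∣ y - x ∣
  abs-sub-comm x y = trans (sym (abs-neg (x - y))) (abs-cong (neg-sub x y))

  abs-*-nonNeg : ∀ x {z} → 0# ≤ z → ∣ x * z ∣ ≈ ∣ x ∣ * z
  abs-*-nonNeg x {z} 0≤z with total 0# x
  ... | inj₁ 0≤x = trans (abs-nonNeg (*-nonNegative 0≤x 0≤z))
    (*-congʳ (sym (abs-nonNeg 0≤x)))
  ... | inj₂ x≤0 = trans
    (abs-nonPos (≤-resp refl (zeroˡ z) (*-monoˡ-≤ 0≤z x≤0)))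
    (trans (-‿distribˡ-* x z) (*-congʳ (sym (abs-nonPos x≤0))))

  -- A nonpositive inverse times `x` would make 1 nonpositive.
  0≤inverse : ∀ {x} (x≉0 : x ≉ 0#) → 0# ≤ x → 0# ≤ proj₁ (invertible x≉0)
  0≤inverse {x} x≉0 0≤x with total 0# (proj₁ (invertible x≉0))
  ... | inj₁ 0≤x⁻¹ = 0≤x⁻¹
  ... | inj₂ x⁻¹≤0 = ⊥-elim (¬1≤0
    (≤-resp (proj₁ (proj₂ (invertible x≉0))) (zeroˡ x) (*-monoˡ-≤ 0≤x x⁻¹≤0)))

  /-≤ : ∀ {x y z} (y≉0 : y ≉ 0#) → 0# ≤ y → x ≤ z * y → x / y [ y≉0 ] ≤ z
  /-≤ y≉0 0≤y x≤zy = ≤-resp refl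
    (trans (*-assoc _ _ _)
      (trans (*-congˡ (proj₂ (proj₂ (invertible y≉0)))) (*-identityʳ _)))
    (*-monoˡ-≤ (0≤inverse y≉0 0≤y) x≤zy)

  -- Distance to a nearest integer

  2*x≈x+x : ∀ x → 2# * x ≈ x + x
  2*x≈x+x x = trans (distribʳ x 1# 1#) (+-cong (*-identityˡ x) (*-identityˡ x))

  x+x≤1⇒x≤½ : ∀ {x} → x + x ≤ 1# → x ≤ ½
  x+x≤1⇒x≤½ {x} x+x≤1 = ≤-resp
    (begin
      (x + x) * ½    ≈⟨ *-comm _ _ ⟩
      ½ * (x + x)    ≈⟨ *-congˡ (2*x≈x+x x) ⟨
      ½ * (2# * x)   ≈⟨ *-assoc _ _ _ ⟨
      (½ * 2#) * x   ≈⟨ *-congʳ ½*2≈1 ⟩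
      1# * x         ≈⟨ *-identityˡ x ⟩
      x              ∎)
    (*-identityˡ ½)
    (*-monoˡ-≤ 0≤½ x+x≤1)
    where open ≈-Reasoning setoid

  nearest-≤½ : ∀ {y n} → IsNearestEven y n → ∣ y - fromℤ n ∣ ≤ ½
  nearest-≤½ {y} {n} isNearest with floor y
  -- `n` is at least as near to `y` as each neighbour `ℤ.suc k` and `k`; adding the two comparisons
  -- bounds twice its distance by `gap`.
  ... | k , k≤y , y<k+1 = x+x≤1⇒x≤½ (≤-resp refl gap
    (+-mono-≤ (nearest (ℤ.suc k)) (nearest k)))
    where
    open IsNearestEven isNearest
    open ≈-Reasoning setoid
    gap : ∣ y - fromℤ (ℤ.suc k) ∣ + ∣ y - fromℤ k ∣ ≈ 1#
    gap = begin
      ∣ y - fromℤ (ℤ.suc k) ∣ + ∣ y - fromℤ k ∣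
        ≈⟨ +-cong (trans (abs-nonPos (y-x≤0 (proj₁ y<k+1))) (neg-sub _ _))
                  (abs-nonNeg (0≤y-x k≤y)) ⟩
      (fromℤ (ℤ.suc k) - y) + (y - fromℤ k)   ≈⟨ +-assoc _ _ _ ⟨
      ((fromℤ (ℤ.suc k) - y) + y) - fromℤ k   ≈⟨ +-congʳ (x-y+y _ y) ⟩
      fromℤ (ℤ.suc k) - fromℤ k               ≈⟨ +-congʳ (fromℤ-suc k) ⟩
      (1# + fromℤ k) - fromℤ k                ≈⟨ x+y-y _ _ ⟩
      1#                                      ∎

  -- Powers of two with integer exponents

  0≤2^ : ∀ z → 0# ≤ 2^ z
  0≤2^ (+ n)    = 0≤^ n 0≤2
  0≤2^ -[1+ n ] = 0≤^ (suc n) 0≤½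

  2*½*x≈x : ∀ x → 2# * (½ * x) ≈ x
  2*½*x≈x x = trans (sym (*-assoc _ _ _))
    (trans (*-congʳ (trans (*-comm _ _) ½*2≈1)) (*-identityˡ x))

  2^-suc : ∀ z → 2^ (ℤ.suc z) ≈ 2# * 2^ z
  2^-suc (+ n)        = refl
  2^-suc -[1+ zero ]  = sym (2*½*x≈x _)
  2^-suc -[1+ suc n ] = sym (2*½*x≈x _)

  2^-shift : ∀ k z → 2^ (+ k ℤ.+ z) ≈ 2# ^ k * 2^ z
  2^-shift zero    z rewrite ℤ.+-identityˡ z = sym (*-identityˡ _)
  2^-shift (suc k) z rewrite suc-shift k z =
    trans (2^-suc (+ k ℤ.+ z)) (trans (*-congˡ (2^-shift k z)) (sym (*-assoc _ _ _)))

  2^-homo-+ : ∀ m n → 2^ (m ℤ.+ n) ≈ 2^ m * 2^ n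
  2^-homo-+ (+ k)    n = 2^-shift k n
  -- A negative exponent is reduced to `2^-shift` by inserting 1 as `½ ^ suc k * 2# ^ suc k`; the
  -- powers of `2#` then shift `m+n` back up to `n`.
  2^-homo-+ -[1+ k ] n = begin
    2^ m+n                                  ≈⟨ *-identityˡ _ ⟨
    1# * 2^ m+n                             ≈⟨ *-congʳ (½^*2^ (suc k)) ⟨
    (½ ^ suc k * 2# ^ suc k) * 2^ m+n       ≈⟨ *-assoc _ _ _ ⟩
    ½ ^ suc k * (2# ^ suc k * 2^ m+n)       ≈⟨ *-congˡ (2^-shift (suc k) m+n) ⟨
    ½ ^ suc k * 2^ (+ suc k ℤ.+ m+n)        ≡⟨ ≡.cong (λ z → ½ ^ suc k * 2^ z) cancel ⟩
    ½ ^ suc k * 2^ n                        ∎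
    where
    open ≈-Reasoning setoid
    m+n : ℤ
    m+n = -[1+ k ] ℤ.+ n
    cancel : + suc k ℤ.+ m+n ≡ n
    cancel = ≡.trans (≡.sym (ℤ.+-assoc (+ suc k) -[1+ k ] n))
      (≡.trans (≡.cong (ℤ._+ n) (ℤ.+-inverseʳ (+ suc k))) (ℤ.+-identityˡ n))

  2^-inverseˡ : ∀ z → 2^ (ℤ.- z) * 2^ z ≈ 1#
  2^-inverseˡ z = trans (sym (2^-homo-+ (ℤ.- z) z))
    (reflexive (≡.cong 2^_ (ℤ.+-inverseˡ z)))

  2^-mono-≤ : ∀ {m n} → m ℤ.≤ n → 2^ m ≤ 2^ n
  2^-mono-≤ {m} {n} m≤n = ≤-resp (*-identityˡ _)
    (trans (sym (2^-shift k m)) (reflexive (≡.cong 2^_ k+m≡n)))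
    (*-monoˡ-≤ (0≤2^ m) (1≤2^ k))
    where
    k : ℕ
    k = ℤ.∣ n ℤ.- m ∣
    k+m≡n : + k ℤ.+ m ≡ n
    k+m≡n = ≡.trans (≡.cong (ℤ._+ m) (ℤ.0≤i⇒+∣i∣≡i (ℤ.i≤j⇒0≤j-i m≤n)))
      (≡.trans (ℤ.+-assoc n (ℤ.- m) m)
        (≡.trans (≡.cong (λ i → n ℤ.+ i) (ℤ.+-inverseˡ m)) (ℤ.+-identityʳ n)))

  2^-cancel-< : ∀ {m n} → 2^ m < 2^ n → m ℤ.< n
  2^-cancel-< 2^m<2^n = ℤ.≰⇒> λ n≤m → <⇒≱ 2^m<2^n (2^-mono-≤ n≤m)

  -- Both sides are 2^(e - p - 1). The right-hand form exposes 2^(e - 1), the lower bound on |x|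
  -- when `e` is the exponent of `x`.
  ½*2^-swap : ∀ e p → ½ * 2^ (e ℤ.- p) ≈ 2^ (ℤ.- p) * 2^ (e ℤ.- + 1)
  ½*2^-swap e p = begin
    ½ * 2^ (e ℤ.- p)                  ≈⟨ *-congˡ (2^-homo-+ e (ℤ.- p)) ⟩
    ½ * (2^ e * 2^ (ℤ.- p))           ≈⟨ *-comm _ _ ⟩
    (2^ e * 2^ (ℤ.- p)) * ½           ≈⟨ *-congʳ (*-comm _ _) ⟩
    (2^ (ℤ.- p) * 2^ e) * ½           ≈⟨ *-assoc _ _ _ ⟩
    -- `2^ -[1+ 0 ]` unfolds to `½ * 1#`, so `½` becomes the power with exponent -1.
    2^ (ℤ.- p) * (2^ e * ½)           ≈⟨ *-congˡ (*-congˡ (*-identityʳ ½)) ⟨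
    2^ (ℤ.- p) * (2^ e * 2^ -[1+ 0 ]) ≈⟨ *-congˡ (2^-homo-+ e -[1+ 0 ]) ⟨
    2^ (ℤ.- p) * 2^ (e ℤ.- + 1)       ∎
    where open ≈-Reasoning setoid

  -- Multiplication by 2^(-z) maps the multiples of 2^z onto the integers and scales distances by
  -- the same factor. With `z` arbitrary, it does not matter which term attains the maximum in `c`.
  scaled-nearest-≤ : ∀ x z {n} → IsNearestEven (x * 2^ (ℤ.- z)) n →
                     ∣ fromℤ n * 2^ z - x ∣ ≤ ½ * 2^ z
  scaled-nearest-≤ x z {n} isNearest = ≤-resp (sym error) refl
    (*-monoˡ-≤ (0≤2^ z) (nearest-≤½ isNearest))
    where
    open ≈-Reasoning setoid
    y s : Carrier
    y = x * 2^ (ℤ.- z)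
    s = 2^ z
    y*s≈x : y * s ≈ x
    y*s≈x = trans (*-assoc _ _ _) (trans (*-congˡ (2^-inverseˡ z)) (*-identityʳ x))
    error : ∣ fromℤ n * s - x ∣ ≈ ∣ y - fromℤ n ∣ * s
    error = begin
      ∣ fromℤ n * s - x ∣         ≈⟨ abs-cong (+-congˡ (-‿cong y*s≈x)) ⟨
      ∣ fromℤ n * s - y * s ∣     ≈⟨ abs-cong (+-congˡ (-‿distribˡ-* y s)) ⟩
      ∣ fromℤ n * s + - y * s ∣   ≈⟨ abs-cong (distribʳ s (fromℤ n) (- y)) ⟨
      ∣ (fromℤ n - y) * s ∣       ≈⟨ abs-*-nonNeg _ (0≤2^ z) ⟩
      ∣ fromℤ n - y ∣ * s         ≈⟨ *-congʳ (abs-sub-comm (fromℤ n) y) ⟩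
      ∣ y - fromℤ n ∣ * s         ∎

  -- Error bounds for a format

  module _ (F : Format) where

    open Format F
    open Rounding ℝ F

    error-≤-½ulp : ∀ x → ∣ R x - x ∣ ≤ ½ * ulp x
    error-≤-½ulp x with x ≟ 0#
    ... | yes x≈0 = ≤-resp (sym ∣0-x∣≈0) refl (*-nonNegative 0≤½ (0≤2^ eₘᵢₙ))
      where
      ∣0-x∣≈0 : ∣ 0# - x ∣ ≈ 0#
      ∣0-x∣≈0 = trans (abs-cong (trans (+-congˡ (-‿cong x≈0)) (-‿inverseʳ 0#)))
        (abs-nonNeg ≤-refl)
    ... | no x≉0 = scaled-nearest-≤ x (c x≉0) (proj₂ (nearestEven _))

    -- Strictness gives 2 - b ≤ e, and the extra 1 cancels against the one by which `P` exceeds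
    -- `fracWidth`.
    eₘᵢₙ≤ : ∀ {e} → + 1 ℤ.- bias ℤ.< e → eₘᵢₙ ℤ.≤ e ℤ.- P
    eₘᵢₙ≤ {e} 1-b<e = ≡.subst (ℤ._≤ e ℤ.- P) shift
      (ℤ.+-monoˡ-≤ (ℤ.- P) (ℤ.i<j⇒suc[i]≤j 1-b<e))
      where
      open ≡.≡-Reasoning
      a : ℤ
      a = + 1 ℤ.- bias
      shift : ℤ.suc a ℤ.- P ≡ a ℤ.- + fracWidth
      shift = begin
        ℤ.suc a ℤ.- P
          ≡⟨ ≡.cong₂ ℤ._-_ (ℤ.+-comm (+ 1) a) (ℤ.pos-+ fracWidth 1) ⟩
        (a ℤ.+ + 1) ℤ.- (+ fracWidth ℤ.+ + 1)
          ≡⟨ ≡.cong (λ i → a ℤ.+ + 1 ℤ.+ i) (ℤ.neg-distrib-+ (+ fracWidth) (+ 1)) ⟩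
        (a ℤ.+ + 1) ℤ.+ (ℤ.- + fracWidth ℤ.+ -[1+ 0 ])
          ≡⟨ ≡.cong (λ i → a ℤ.+ + 1 ℤ.+ i) (ℤ.+-comm (ℤ.- + fracWidth) -[1+ 0 ]) ⟩
        (a ℤ.+ + 1) ℤ.+ (-[1+ 0 ] ℤ.+ ℤ.- + fracWidth)
          ≡⟨ ℤ.+-assoc (a ℤ.+ + 1) -[1+ 0 ] (ℤ.- + fracWidth) ⟨
        (a ℤ.+ + 1 ℤ.+ -[1+ 0 ]) ℤ.+ ℤ.- + fracWidth
          ≡⟨ ≡.cong (ℤ._+ ℤ.- + fracWidth)
               (≡.trans (ℤ.+-assoc a (+ 1) -[1+ 0 ]) (ℤ.+-identityʳ a)) ⟩
        a ℤ.- + fracWidth ∎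

    ½ulp-≤-normal : ∀ x → x ≉ 0# → 2^ (+ 1 ℤ.- bias) ≤ ∣ x ∣ →
                    ½ * ulp x ≤ 2^ (ℤ.- P) * ∣ x ∣
    ½ulp-≤-normal x x≉0 normal with x ≟ 0#
    ... | yes x≈0 = ⊥-elim (x≉0 x≈0)
    -- `ulp x` takes its exponent from the evidence returned by the zero test, so `e` is computed
    -- from `x≉0′` as well.
    ... | no x≉0′ = ≤-resp
      (trans (*-comm _ _) (trans (sym (½*2^-swap e P)) (*-congˡ (reflexive (≡.cong 2^_ (≡.sym c≡e-P))))))
      (*-comm _ _)
      (*-monoˡ-≤ (0≤2^ (ℤ.- P)) (IsExponent.lower isExponent))
      where
      e : ℤ
      e = proj₁ (exponent x≉0′)
      isExponent : IsExponent x e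
      isExponent = proj₂ (exponent x≉0′)
      1-b<e : + 1 ℤ.- bias ℤ.< e
      -- Otherwise 2^e ≤ 2^(1 - b) ≤ |x|, against |x| < 2^e.
      1-b<e = 2^-cancel-< (≰⇒> λ 2^e≤2^1-b →
        <⇒≱ (IsExponent.upper isExponent) (≤-trans 2^e≤2^1-b normal))
      c≡e-P : c x≉0′ ≡ e ℤ.- P
      c≡e-P = ℤ.i≥j⇒i⊔j≡i (eₘᵢₙ≤ 1-b<e)

theorem1 : {ℓ : Level} (ℝ : Reals ℓ) (F : Format) →
    let open Reals ℝ
        open RealArithmetic ℝ
        open Format F
        open Rounding ℝ F
    in (∀ x → ∣ R x - x ∣ ≤ ½ * ulp x)
       × (∀ x (x≉0 : x ≉ 0#) → 2^ (+ 1 ℤ.- bias) ≤ ∣ x ∣ →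
          ∣ R x - x ∣ / ∣ x ∣ [ ∣x∣≉0 x≉0 ] ≤ 2^ (ℤ.- P))
theorem1 ℝ F = error-≤-½ulp ℝ F , λ x x≉0 normal →
  /-≤ ℝ (∣x∣≉0 x≉0) (0≤abs x)
    (≤-trans (error-≤-½ulp ℝ F x) (½ulp-≤-normal ℝ F x x≉0 normal))
  where
  open Reals ℝ
  open RealArithmetic ℝ
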